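{- There exist constants $c>0$ and $n_0$ such that for all $n\ge n_0$, $$\mathrm{ex}_3\big(n,\Theta^{B}_{3,217}\big)\ \ge\ c\, n^{4/3},$$ i.e. $\mathrm{ex}_3(n,\Theta^{B}_{3,217})=\Omega(n^{4/3})$.
   Context: For integers $\ell\ge 2$, $t\ge 1$, an $r$-uniform hypergraph $\mathcal{G}$ contains a Berge theta hypergraph $\Theta^{B}_{\ell,t}$ if it has distinct vertices $x,y,v^1_1,\dots,v^1_{\ell-1},\dots,v^t_1,\dots,v^t_{\ell-1}$ and distinct edges $e^1_1,\dots,e^1_\ell,\dots,e^t_1,\dots,e^t_\ell$ such that for every $1\le i\le t$: $\{x,v^i_1\}\subseteq e^i_1$, $\{v^i_{j-1},v^i_j\}\subseteq e^i_j$ for $2\le j\le \ell-1$, and $\{v^i_{\ell-1},y\}\subseteq e^i_\ell$. (Equivalently, there are $t$ internally disjoint Berge paths of length $\ell$ with common endpoints $x,y$, using pairwise distinct edges.) The Turán number $\mathrm{ex}_r(n,\Theta^{B}_{\ell,t})$ is the maximum number of edges in an $r$-uniform hypergraph on $n$ vertices that does not contain $\Theta^{B}_{\ell,t}$. -}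

module Defs where

open import Data.Nat using (ℕ; zero; suc; _∸_)
open import Data.Fin using (Fin; zero; suc; inject₁; _<_)
open import Data.Product using (_×_; _,_; Σ; ∃)
open import Data.Sum using (_⊎_)
open import Data.List using (List; length; lookup)
open import Data.List.Relation.Unary.All using (All)
open import Data.List.Relation.Unary.Unique.Propositional using (Unique)
open import Relation.Binary.PropositionalEquality using (_≡_)
open import Function.Definitions using (Injective)
open import Function using (_∘_)

-- An edge of a 3-uniform hypergraph on vertex set Fin n is a 3-set {a,b,c},
-- represented canonically as a strictly increasing triple (a , b , c).
Triple : ℕ → Set
Triple n = Fin n × Fin n × Fin n

Increasing : {n : ℕ} → Triple n → Set
Increasing (a , b , c) = (a < b) × (b < c)

record Hypergraph3 (n : ℕ) : Set where
  field
    edges      : List (Triple n)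
    increasing : All Increasing edges
    distinct   : Unique edges

open Hypergraph3 public

∣E∣ : {n : ℕ} → Hypergraph3 n → ℕ
∣E∣ H = length (edges H)

_∈ₑ_ : {n : ℕ} → Fin n → Triple n → Set
v ∈ₑ (a , b , c) = (v ≡ a) ⊎ (v ≡ b) ⊎ (v ≡ c)

pathSeq : {n : ℕ} (m : ℕ) → Fin n → Fin n → (Fin m → Fin n) → Fin (suc (suc m)) → Fin n
pathSeq m       x y v zero          = x
pathSeq zero    x y v (suc zero)    = y
pathSeq (suc m) x y v (suc k)       = pathSeq m (v zero) y (v ∘ suc) k

-- indices of the vertices of Θ: x (= inj₁ zero), y (= inj₁ (suc zero)),
-- and the inner vertices v^i_j (i < t, j < ℓ-1)
ThetaVertex : (ℓ t : ℕ) → Set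
ThetaVertex ℓ t = Fin 2 ⊎ (Fin t × Fin (ℓ ∸ 1))

-- H contains a Berge theta hypergraph Θ^B_{ℓ,t} (for ℓ ≥ 1; used with ℓ ≥ 2).
-- x , y , v are the vertices (all distinct, via an injective assignment),
-- e i j (i < t, j < ℓ) are the edges (pairwise distinct, via an injective map
-- into the positions of the duplicate-free edge list), and edge e i j contains
-- the j-th and (j+1)-th vertex of the i-th path  x , v^i_1 , … , v^i_{ℓ-1} , y.
ContainsBergeTheta : {n : ℕ} (ℓ t : ℕ) → Hypergraph3 n → Set
ContainsBergeTheta {n} ℓ t H =
  Σ (ThetaVertex ℓ t → Fin n) λ φ →
  Σ (Fin t × Fin (suc (ℓ ∸ 1)) → Fin (length (edges H))) λ e →
    Injective _≡_ _≡_ φ ×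
    Injective _≡_ _≡_ e ×
    ((i : Fin t) (j : Fin (suc (ℓ ∸ 1))) →
      let w = pathSeq (ℓ ∸ 1) (φ (Data.Sum.inj₁ zero)) (φ (Data.Sum.inj₁ (suc zero)))
                      (λ k → φ (Data.Sum.inj₂ (i , k)))
          E = lookup (edges H) (e (i , j))
      in (w (inject₁ j) ∈ₑ E) × (w (suc j) ∈ₑ E))

{-# OPTIONS --safe #-}

-- Let p be prime.  The Wenger graph joins the point (x , u , v) to the line
-- (y , xy + u , x²y + v) over ℤ/p; it has 2p³ vertices and p⁴ edges, and it
-- contains no hexagon: going around one, the differences d₁, d₂, d₃ of the
-- y-coordinates satisfy Σ dᵢ = Σ xᵢ dᵢ = Σ xᵢ² dᵢ = 0, and Vandermonde forces
-- two consecutive edges to coincide.  Double each point P into P , P′ and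
-- replace the edge PL by the triple {P , P′ , L}.  A Berge path of length 3
-- between two doubled points must use the twin of one endpoint next to that
-- endpoint, so there are at most two internally disjoint ones; two paths
-- between two lines give a quadrangle of the Wenger graph, and two paths
-- between a doubled point and a line give a hexagon.
--
-- Primes are supplied by a weak form of Bertrand's postulate: the central
-- entries of Leibniz's harmonic triangle divide every common multiple of
-- 1 , … , M, whereas without primes in (m , M] there is a common multiple of
-- size at most M^√M · ∏_{p ≤ m} p.

module Submission where

open import Defs
open import Data.Nat as ℕ using (ℕ; zero; suc; NonZero; z<s; s<s)
import Data.Nat.Properties as ℕ
open import Data.Nat.DivMod using (_mod_; _%_; _/_; m≡m%n+[m/n]*n; m%n<n)
open import Data.Nat.Primality using (Prime; prime?; euclidsLemma; prime⇒nonZero; prime⇒nonTrivial)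
open import Data.Fin as Fin using (Fin; toℕ; combine; remQuot; inject≤; cast)
open import Data.Fin.Patterns using (0F; 1F; 2F)
open import Data.Fin.Properties using (toℕ-injective; toℕ<n; toℕ-fromℕ<; combine-injective;
  combine-remQuot; combine-monoˡ-<; inject≤-injective; toℕ-inject≤; cast-involutive)
open import Data.List using ([]; _∷_; length; lookup; tabulate)
open import Data.List.Properties using (length-tabulate; lookup-tabulate)
open import Data.List.Relation.Unary.All using ([]; _∷_)
import Data.List.Relation.Unary.All.Properties as All
import Data.List.Relation.Unary.Unique.Propositional.Properties as Unique
open import Data.Product using (Σ; ∃; _×_; _,_; proj₁; proj₂; map₂)
open import Data.Product.Properties using (,-injective)
open import Data.Sum using (_⊎_; inj₁; inj₂)
open import Data.Empty using (⊥; ⊥-elim)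
open import Data.Unit using (tt)
open import Function using (_∘_; case_of_)
open import Function.Definitions using (Injective)
open import Relation.Nullary using (¬_; yes; no; contradiction; _×-dec_)
open import Relation.Binary.PropositionalEquality

module Primes where

  open import Data.Nat
  open import Data.Nat.Properties
  open import Data.Nat.Divisibility
  open import Data.Nat.Primality.Factorisation using (PrimeFactorisation; factorise)
  open import Data.Nat.ListAction using (product)
  open import Data.Nat.Induction using (<-rec)
  open import Data.Nat.Tactic.RingSolver using (solve-∀)

  bracket : (f : ℕ → ℕ) → (∀ k → f k < f (suc k)) →
            ∀ n → f 0 ≤ n → ∃ λ k → f k ≤ n × n < f (suc k)
  bracket f inc zero f0≤n = 0 , f0≤n , ≤-<-trans z≤n (inc 0)
  bracket f inc (suc n) f0≤n with f 0 ≤? n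
  ... | no f0≰n = 0 , f0≤n , ≤-<-trans (≰⇒> f0≰n) (inc 0)
  ... | yes f0≤n′ with bracket f inc n f0≤n′
  ...   | k , fk≤n , n<fk+1 with f (suc k) ≤? suc n
  ...     | yes le = suc k , le , ≤-<-trans n<fk+1 (inc (suc k))
  ...     | no  gt = k , m≤n⇒m≤1+n fk≤n , ≰⇒> gt

  -- bin i j is the binomial coefficient (i + j choose i).
  bin : ℕ → ℕ → ℕ
  bin zero    j       = 1
  bin (suc i) zero    = 1
  bin (suc i) (suc j) = bin i (suc j) + bin (suc i) j

  bin-zeroʳ : ∀ i → bin i 0 ≡ 1
  bin-zeroʳ zero    = refl
  bin-zeroʳ (suc i) = refl

  bin-absorbˡ : ∀ i j → suc i * bin (suc i) j ≡ suc (i + j) * bin i j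
  bin-absorbʳ : ∀ i j → suc j * bin i (suc j) ≡ suc (i + j) * bin i j
  bin-absorbˡ i zero rewrite bin-zeroʳ i | +-identityʳ i = refl
  bin-absorbˡ i (suc j) = begin
    suc i * (bin i (suc j) + bin (suc i) j)
      ≡⟨ *-distribˡ-+ (suc i) (bin i (suc j)) _ ⟩
    suc i * bin i (suc j) + suc i * bin (suc i) j
      ≡⟨ cong (suc i * bin i (suc j) +_) (trans (bin-absorbˡ i j) (sym (bin-absorbʳ i j))) ⟩
    suc i * bin i (suc j) + suc j * bin i (suc j)
      ≡⟨ collect i j (bin i (suc j)) ⟩
    suc (i + suc j) * bin i (suc j) ∎
    where
    open ≡-Reasoning
    collect : ∀ i j b → suc i * b + suc j * b ≡ suc (i + suc j) * b
    collect = solve-∀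
  bin-absorbʳ zero j = refl
  bin-absorbʳ (suc i) j = begin
    suc j * (bin i (suc j) + bin (suc i) j)
      ≡⟨ *-distribˡ-+ (suc j) (bin i (suc j)) _ ⟩
    suc j * bin i (suc j) + suc j * bin (suc i) j
      ≡⟨ cong (_+ suc j * bin (suc i) j) (trans (bin-absorbʳ i j) (sym (bin-absorbˡ i j))) ⟩
    suc i * bin (suc i) j + suc j * bin (suc i) j
      ≡⟨ collect i j (bin (suc i) j) ⟩
    suc (suc i + j) * bin (suc i) j ∎
    where
    open ≡-Reasoning
    collect : ∀ i j b → suc i * b + suc j * b ≡ suc (suc i + j) * b
    collect = solve-∀

  bin>0 : ∀ i j → 0 < bin i j
  bin>0 zero    j       = z<s
  bin>0 (suc i) zero    = z<s
  bin>0 (suc i) (suc j) = <-≤-trans (bin>0 i (suc j)) (m≤m+n _ _)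

  bin≤2^ : ∀ i j → bin i j ≤ 2 ^ (i + j)
  bin≤2^ zero    j       = m^n>0 2 j
  bin≤2^ (suc i) zero    = m^n>0 2 (suc i + 0)
  bin≤2^ (suc i) (suc j) = begin
    bin i (suc j) + bin (suc i) j       ≤⟨ +-mono-≤ (bin≤2^ i (suc j)) (bin≤2^ (suc i) j) ⟩
    2 ^ (i + suc j) + 2 ^ suc (i + j)   ≡⟨ cong (λ k → 2 ^ (i + suc j) + 2 ^ k) (+-suc i j) ⟨
    2 ^ (i + suc j) + 2 ^ (i + suc j)   ≡⟨ cong (2 ^ (i + suc j) +_) (+-identityʳ _) ⟨
    2 ^ (suc i + suc j)                 ∎
    where open ≤-Reasoning

  bin-diag≥2^ : ∀ n → 2 ^ n ≤ bin n n
  bin-diag≥2^ zero    = ≤-refl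
  bin-diag≥2^ (suc n) = begin
    2 ^ n + (2 ^ n + 0)             ≡⟨ cong (2 ^ n +_) (+-identityʳ _) ⟩
    2 ^ n + 2 ^ n                   ≤⟨ +-mono-≤ (bin-diag≥2^ n) (bin-diag≥2^ n) ⟩
    bin n n + bin n n               ≤⟨ +-mono-≤ (incʳ n n) (incˡ n n) ⟩
    bin n (suc n) + bin (suc n) n   ∎
    where
    open ≤-Reasoning
    incˡ : ∀ i j → bin i j ≤ bin (suc i) j
    incˡ i zero    = ≤-reflexive (bin-zeroʳ i)
    incˡ i (suc j) = m≤m+n _ _
    incʳ : ∀ i j → bin i j ≤ bin i (suc j)
    incʳ zero    j = ≤-refl
    incʳ (suc i) j = m≤n+m _ _

  bin-! : ∀ i j → bin i j * (i ! * j !) ≡ (i + j) !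
  bin-! zero    j = trans (*-identityˡ _) (*-identityˡ _)
  bin-! (suc i) j = begin
    bin (suc i) j * (suc i * i ! * j !)  ≡⟨ regroup (bin (suc i) j) (suc i) (i !) (j !) ⟩
    suc i * bin (suc i) j * (i ! * j !)  ≡⟨ cong (_* (i ! * j !)) (bin-absorbˡ i j) ⟩
    suc (i + j) * bin i j * (i ! * j !)  ≡⟨ *-assoc (suc (i + j)) (bin i j) _ ⟩
    suc (i + j) * (bin i j * (i ! * j !)) ≡⟨ cong (suc (i + j) *_) (bin-! i j) ⟩
    suc (i + j) * (i + j) !              ∎
    where
    open ≡-Reasoning
    regroup : ∀ b s x y → b * (s * x * y) ≡ s * b * (x * y)
    regroup = solve-∀

  leibniz : ℕ → ℕ → ℕ
  leibniz i j = suc (i + j) * bin i j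

  -- 1/L(i+1,j) + 1/L(i,j+1) = 1/L(i,j) (Leibniz's harmonic triangle), cleared of denominators.
  leibniz-harmonic : ∀ i j → leibniz (suc i) j * leibniz i (suc j) ≡
                             leibniz i j * (leibniz i (suc j) + leibniz (suc i) j)
  leibniz-harmonic i j = begin
    suc (suc i + j) * B₁ * (suc (i + suc j) * B₂)
      ≡⟨ cong (λ k → suc (suc i + j) * B₁ * (suc k * B₂)) (+-suc i j) ⟩
    suc (suc i + j) * B₁ * (suc (suc i + j) * B₂)
      ≡⟨ expand i j B₁ B₂ ⟩
    suc (suc i + j) * (suc i * B₁ * B₂ + suc j * B₂ * B₁)
      ≡⟨ cong₂ (λ x y → suc (suc i + j) * (x * B₂ + y * B₁)) (bin-absorbˡ i j) (bin-absorbʳ i j) ⟩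
    suc (suc i + j) * (L * B₂ + L * B₁)
      ≡⟨ collect (suc (suc i + j)) L B₁ B₂ ⟩
    L * (suc (suc i + j) * B₂ + suc (suc i + j) * B₁)
      ≡⟨ cong (λ k → L * (suc k * B₂ + suc (suc i + j) * B₁)) (+-suc i j) ⟨
    L * (suc (i + suc j) * B₂ + suc (suc i + j) * B₁) ∎
    where
    open ≡-Reasoning
    B₁ = bin (suc i) j
    B₂ = bin i (suc j)
    L  = leibniz i j
    expand : ∀ i j b c → suc (suc i + j) * b * (suc (suc i + j) * c) ≡
                         suc (suc i + j) * (suc i * b * c + suc j * c * b)
    expand = solve-∀
    collect : ∀ s l b c → s * (l * c + l * b) ≡ l * (s * c + s * b)
    collect = solve-∀

  leibniz>0 : ∀ i j → 0 < leibniz i j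
  leibniz>0 i j = <-≤-trans (bin>0 i j) (m≤m+n _ _)

  leibniz-∣ : ∀ i j K → (∀ k → 0 < k → k ≤ suc (i + j) → k ∣ K) → leibniz i j ∣ K
  leibniz-∣ i zero K all rewrite bin-zeroʳ i | *-identityʳ (suc (i + 0)) = all _ z<s ≤-refl
  leibniz-∣ i (suc j) K all
    with leibniz-∣ i j K (λ k 0<k k≤ → all k 0<k (≤-trans k≤ (s≤s (+-monoʳ-≤ i (n≤1+n j)))))
       | leibniz-∣ (suc i) j K (λ k 0<k k≤ → all k 0<k (≤-trans k≤ (s≤s (≤-reflexive (sym (+-suc i j))))))
  ... | divides a K≡aL₀ | divides b K≡bL₁ = ∣m+n∣m⇒∣n (divides a eq) (n∣m*n b)
    where
    L₀ = leibniz i j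
    L₁ = leibniz (suc i) j
    L₂ = leibniz i (suc j)
    instance
      _ : NonZero L₁
      _ = >-nonZero (leibniz>0 (suc i) j)
    open ≡-Reasoning
    eq : b * L₂ + K ≡ a * L₂
    eq = *-cancelʳ-≡ (b * L₂ + K) (a * L₂) L₁ (begin
      (b * L₂ + K) * L₁       ≡⟨ r₁ K b L₁ L₂ ⟩
      K * L₁ + b * L₁ * L₂    ≡⟨ cong (λ x → K * L₁ + x * L₂) K≡bL₁ ⟨
      K * L₁ + K * L₂         ≡⟨ cong (λ x → x * L₁ + x * L₂) K≡aL₀ ⟩
      a * L₀ * L₁ + a * L₀ * L₂ ≡⟨ r₂ a L₀ L₁ L₂ ⟩
      a * (L₀ * (L₂ + L₁))    ≡⟨ cong (a *_) (leibniz-harmonic i j) ⟨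
      a * (L₁ * L₂)           ≡⟨ r₃ a L₁ L₂ ⟩
      a * L₂ * L₁             ∎)
      where
      r₁ : ∀ K b x y → (b * y + K) * x ≡ K * x + b * x * y
      r₁ = solve-∀
      r₂ : ∀ a l x y → a * l * x + a * l * y ≡ a * (l * (y + x))
      r₂ = solve-∀
      r₃ : ∀ a x y → a * (x * y) ≡ a * y * x
      r₃ = solve-∀

  prime>1 : ∀ {p} → Prime p → 1 < p
  prime>1 pr = nonTrivial⇒n>1 _ {{prime⇒nonTrivial pr}}

  prime∤1 : ∀ {p} → Prime p → ¬ p ∣ 1
  prime∤1 pr p∣1 = <⇒≱ (prime>1 pr) (∣⇒≤ p∣1)

  prime∣! : ∀ {p} → Prime p → ∀ n → p ∣ n ! → p ≤ n
  prime∣! pr zero    p∣1  = contradiction p∣1 (prime∤1 pr)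
  prime∣! pr (suc n) p∣n! with euclidsLemma (suc n) (n !) pr p∣n!
  ... | inj₁ p∣n  = ∣⇒≤ p∣n
  ... | inj₂ p∣n! = m≤n⇒m≤1+n (prime∣! pr n p∣n!)

  n∣n! : ∀ n → 0 < n → n ∣ n !
  n∣n! (suc n) _ = m∣m*n (n !)

  prime∣bin-diag : ∀ {p} → Prime p → ∀ n → n < p → p ≤ n + n → p ∣ bin n n
  prime∣bin-diag {p} pr n n<p p≤2n
    with euclidsLemma (bin n n) (n ! * n !) pr (subst (p ∣_) (sym (bin-! n n))
           (∣-trans (n∣n! p (≤-trans z<s n<p)) (m≤n⇒m!∣n! p≤2n)))
  ... | inj₁ p∣bin = p∣bin
  ... | inj₂ p∣n!² with euclidsLemma (n !) (n !) pr p∣n!²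
  ...   | inj₁ p∣n! = contradiction (prime∣! pr n p∣n!) (<⇒≱ n<p)
  ...   | inj₂ p∣n! = contradiction (prime∣! pr n p∣n!) (<⇒≱ n<p)

  primeOr1 : ℕ → ℕ
  primeOr1 q with prime? q
  ... | yes _ = q
  ... | no  _ = 1

  primeOr1>0 : ∀ q → 0 < primeOr1 q
  primeOr1>0 q with prime? q
  ... | yes pr = <-trans z<s (prime>1 pr)
  ... | no  _  = z<s

  -- The product of the primes in (n, n + k].
  primorial : ℕ → ℕ → ℕ
  primorial n zero    = 1
  primorial n (suc k) = primeOr1 (n + suc k) * primorial n k

  primorial>0 : ∀ n k → 0 < primorial n k
  primorial>0 n zero    = z<s
  primorial>0 n (suc k) = *-mono-≤ (primeOr1>0 (n + suc k)) (primorial>0 n k)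

  primorial-split : ∀ n a b → primorial n (a + b) ≡ primorial n a * primorial (n + a) b
  primorial-split n a zero rewrite +-identityʳ a = sym (*-identityʳ _)
  primorial-split n a (suc b) = begin
    primorial n (a + suc b)                       ≡⟨ cong (primorial n) (+-suc a b) ⟩
    primeOr1 (n + suc (a + b)) * primorial n (a + b)
      ≡⟨ cong₂ (λ x y → primeOr1 x * y) shift (primorial-split n a b) ⟩
    primeOr1 (n + a + suc b) * (primorial n a * primorial (n + a) b)
      ≡⟨ swap (primeOr1 (n + a + suc b)) (primorial n a) _ ⟩
    primorial n a * primorial (n + a) (suc b)     ∎
    where
    open ≡-Reasoning
    shift : n + suc (a + b) ≡ n + a + suc b
    shift = trans (cong (n +_) (sym (+-suc a b))) (sym (+-assoc n a (suc b)))
    swap : ∀ x y z → x * (y * z) ≡ y * (x * z)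
    swap = solve-∀

  prime∣primorial : ∀ {p} → Prime p → ∀ n k → p ∣ primorial n k → p ≤ n + k
  prime∣primorial pr n zero p∣1 = contradiction p∣1 (prime∤1 pr)
  prime∣primorial pr n (suc k) p∣ with prime? (n + suc k)
  ... | no _ = ≤-trans (prime∣primorial pr n k (subst (_ ∣_) (*-identityˡ _) p∣)) (+-monoʳ-≤ n (n≤1+n k))
  ... | yes q-prime with euclidsLemma (n + suc k) _ pr p∣
  ...   | inj₁ p∣q = ∣⇒≤ {{prime⇒nonZero q-prime}} p∣q
  ...   | inj₂ p∣Π = ≤-trans (prime∣primorial pr n k p∣Π) (+-monoʳ-≤ n (n≤1+n k))

  primorial-∣-bin : ∀ n k → k ≤ n → primorial n k ∣ bin n n
  primorial-∣-bin n zero    _   = 1∣ _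
  primorial-∣-bin n (suc k) k<n with prime? (n + suc k) | primorial-∣-bin n k (<⇒≤ k<n)
  ... | no  _  | ih = subst (_∣ bin n n) (sym (*-identityˡ _)) ih
  ... | yes pr | divides c eq
        with euclidsLemma c (primorial n k) pr
               (subst (n + suc k ∣_) eq (prime∣bin-diag pr n (m<m+n n z<s) (+-monoʳ-≤ n k<n)))
  ...   | inj₁ q∣c = subst ((n + suc k) * primorial n k ∣_) (sym eq) (*-monoˡ-∣ (primorial n k) q∣c)
  ...   | inj₂ q∣Π = contradiction (prime∣primorial pr n k q∣Π) (<⇒≱ (+-monoʳ-< n (n<1+n k)))

  primorial-2^ : ∀ i → primorial 0 (2 ^ i) ≤ 2 ^ (2 * 2 ^ i)
  primorial-2^ zero    = s≤s z≤n
  primorial-2^ (suc i) = begin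
    primorial 0 (N + (N + 0))         ≡⟨ cong (λ k → primorial 0 (N + k)) (+-identityʳ N) ⟩
    primorial 0 (N + N)               ≡⟨ primorial-split 0 N N ⟩
    primorial 0 N * primorial N N     ≤⟨ *-mono-≤ (primorial-2^ i) (≤-trans
                                           (∣⇒≤ {{>-nonZero (bin>0 N N)}} (primorial-∣-bin N N ≤-refl))
                                           (bin≤2^ N N)) ⟩
    2 ^ (2 * N) * 2 ^ (N + N)         ≡⟨ ^-distribˡ-+-* 2 (2 * N) (N + N) ⟨
    2 ^ (2 * N + (N + N))             ≡⟨ cong (2 ^_) (double N) ⟩
    2 ^ (2 * (2 * N))                 ∎
    where
    open ≤-Reasoning
    N = 2 ^ i
    double : ∀ N → 2 * N + (N + N) ≡ 2 * (2 * N)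
    double = solve-∀

  prime-divisor : ∀ n → 1 < n → ∃ λ p → Prime p × p ∣ n
  prime-divisor n@(suc _) 1<n = go (factorise n)
    where
    go : PrimeFactorisation n → ∃ λ p → Prime p × p ∣ n
    go record { factors = []; isFactorisation = n≡1 } = contradiction (sym n≡1) (<⇒≢ 1<n)
    go record { factors = p ∷ ps; isFactorisation = eq; factorsPrime = pr ∷ _ } =
      p , pr , subst (p ∣_) (sym eq) (m∣m*n (product ps))

  strip : ∀ {p} → Prime p → ∀ j → 0 < j → ∃ λ v → ∃ λ r → j ≡ p ^ v * r × ¬ p ∣ r
  strip {p} pr = <-rec _ step
    where
    step : ∀ j → (∀ {i} → i < j → 0 < i → ∃ λ v → ∃ λ r → i ≡ p ^ v * r × ¬ p ∣ r) →
           0 < j → ∃ λ v → ∃ λ r → j ≡ p ^ v * r × ¬ p ∣ r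
    step j rec 0<j with p ∣? j
    ... | no p∤j = 0 , j , sym (*-identityˡ j) , p∤j
    ... | yes (divides zero j≡0) = contradiction (sym j≡0) (<⇒≢ 0<j)
    ... | yes (divides i@(suc _) j≡ip)
        with rec (subst (i <_) (sym j≡ip) (m<m*n i p (prime>1 pr))) z<s
    ...   | v , r , i≡ , p∤r = suc v , r ,
            trans j≡ip (trans (*-comm i p) (trans (cong (p *_) i≡) (sym (*-assoc p (p ^ v) r)))) , p∤r

  Covers : ℕ → ℕ → ℕ → Set
  Covers M m K = ∀ j → 0 < j → j ≤ M → (∀ q → Prime q → q ∣ j → q ≤ m) → j ∣ K

  covers-zero : ∀ M → Covers M 0 1
  covers-zero M 1 _ _ _ = ∣-refl
  covers-zero M (suc (suc j)) _ _ smooth with prime-divisor (2+ j) (s≤s z<s)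
  ... | q , pr , q∣j = contradiction (smooth q pr q∣j) (<⇒≱ (<-trans z<s (prime>1 pr)))

  covers-nonprime : ∀ {M m K} → ¬ Prime (suc m) → Covers M m K → Covers M (suc m) K
  covers-nonprime ¬pr cov j 0<j j≤M smooth = cov j 0<j j≤M λ q pr q∣j →
    s≤s⁻¹ (≤∧≢⇒< (smooth q pr q∣j) λ { refl → ¬pr pr })

  covers-prime : ∀ {M m K} → Prime (suc m) → ∀ k → M < suc m ^ suc k →
                 Covers M m K → Covers M (suc m) (suc m ^ k * K)
  covers-prime {M} {m} {K} pr k M< cov j 0<j j≤M smooth with strip pr j 0<j
  ... | v , zero , j≡0 , p∤r = contradiction (_ ∣0) p∤r
  ... | v , r@(suc _) , j≡ , p∤r = subst (_∣ p ^ k * K) (sym j≡) (*-pres-∣ p^v∣p^k r∣K)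
    where
    p = suc m
    r∣j : r ∣ j
    r∣j = divides (p ^ v) j≡
    p^v≤M : p ^ v ≤ M
    p^v≤M = ≤-trans (subst (p ^ v ≤_) (sym j≡) (m≤m*n (p ^ v) r)) j≤M
    v≤k : v ≤ k
    v≤k = ≮⇒≥ λ k<v → <⇒≱ M< (≤-trans (^-monoʳ-≤ p k<v) p^v≤M)
    p^v∣p^k : p ^ v ∣ p ^ k
    p^v∣p^k = divides (p ^ (k ∸ v)) (trans (cong (p ^_) (sym (m∸n+n≡m v≤k))) (^-distribˡ-+-* p (k ∸ v) v))
    r∣K : r ∣ K
    r∣K = cov r z<s (≤-trans (∣⇒≤ {{>-nonZero 0<j}} r∣j) j≤M) λ q q-prime q∣r →
      s≤s⁻¹ (≤∧≢⇒< (smooth q q-prime (∣-trans q∣r r∣j)) λ { refl → p∤r q∣r })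

  -- Every prime contributes at most M ...
  cover-small : ∀ M → 1 ≤ M → ∀ m → ∃ λ K → Covers M m K × 0 < K × K ≤ M ^ m
  cover-small M 1≤M zero = 1 , covers-zero M , z<s , ≤-refl
  cover-small M 1≤M (suc m) with prime? (suc m) | cover-small M 1≤M m
  ... | no ¬pr | K , cov , 0<K , K≤ =
        K , covers-nonprime ¬pr cov , 0<K , ≤-trans K≤ (m≤n*m _ M {{>-nonZero 1≤M}})
  ... | yes pr | K , cov , 0<K , K≤
        with bracket (suc m ^_) (λ k → ^-monoʳ-< (suc m) (prime>1 pr) (n<1+n k)) M 1≤M
  ...   | k , p^k≤M , M<p^k+1 = suc m ^ k * K , covers-prime pr k M<p^k+1 cov ,
          *-mono-≤ (m^n>0 (suc m) k) 0<K , *-mono-≤ p^k≤M K≤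

  -- ... and a prime exceeding √M contributes only itself.
  cover-large : ∀ M s → 1 ≤ M → M < suc s * suc s → ∀ d →
                ∃ λ K → Covers M (s + d) K × 0 < K × K ≤ M ^ s * primorial s d
  cover-large M s 1≤M M<s² zero with cover-small M 1≤M s
  ... | K , cov , 0<K , K≤ = K , subst (λ m → Covers M m K) (sym (+-identityʳ s)) cov , 0<K ,
        ≤-trans K≤ (≤-reflexive (sym (*-identityʳ _)))
  cover-large M s 1≤M M<s² (suc d) rewrite +-suc s d with prime? (suc (s + d)) | cover-large M s 1≤M M<s² d
  ... | no ¬pr | K , cov , 0<K , K≤ = K , covers-nonprime ¬pr cov , 0<K ,
        ≤-trans K≤ (≤-reflexive (cong (M ^ s *_) (sym (*-identityˡ _))))
  ... | yes pr | K , cov , 0<K , K≤ = suc (s + d) ^ 1 * K ,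
        covers-prime pr 1 (<-≤-trans M<s² (*-mono-≤ s≤p (≤-trans s≤p (m≤m*n _ 1)))) cov ,
        *-mono-≤ (m^n>0 (suc (s + d)) 1) 0<K ,
        ≤-trans (*-mono-≤ (≤-reflexive (^-identityʳ (suc (s + d)))) K≤)
                (≤-reflexive (swap (suc (s + d)) (M ^ s) (primorial s d)))
    where
    s≤p : suc s ≤ suc (s + d)
    s≤p = s≤s (m≤m+n s d)
    swap : ∀ x y z → x * (y * z) ≡ y * (x * z)
    swap = solve-∀

  leibniz-bound : ∀ M s d n → M < suc s * suc s → suc (n + n) ≤ M →
                  (∀ q → Prime q → q ≤ M → q ≤ s + d) →
                  leibniz n n ≤ M ^ s * primorial s d
  leibniz-bound M s d n M<s² 2n<M gap with cover-large M s (≤-trans z<s 2n<M) M<s² d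
  ... | K , cov , 0<K , K≤ = ≤-trans (∣⇒≤ {{>-nonZero 0<K}} (leibniz-∣ n n K λ k 0<k k≤ →
          cov k 0<k (≤-trans k≤ 2n<M) λ q pr q∣k →
            gap q pr (≤-trans (∣⇒≤ {{>-nonZero 0<k}} q∣k) (≤-trans k≤ 2n<M)))) K≤

  leibniz-diag≥2^ : ∀ n → 1 ≤ n → 2 ^ suc n ≤ leibniz n n
  leibniz-diag≥2^ n 1≤n = *-mono-≤ (s≤s (≤-trans 1≤n (m≤m+n n n))) (bin-diag≥2^ n)

  4*[5+k]<3*2^[3+k] : ∀ k → 4 * (5 + k) < 3 * 2 ^ (3 + k)
  4*[5+k]<3*2^[3+k] zero = s≤s (m≤m+n 20 3)
  4*[5+k]<3*2^[3+k] (suc k) = begin-strict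
    4 * (6 + k)                         ≡⟨ r₁ k ⟩
    4 * (5 + k) + 4                     <⟨ +-mono-<-≤ (4*[5+k]<3*2^[3+k] k)
                                             (≤-trans (m≤m*n 4 3) (*-monoʳ-≤ 3 4≤2^[3+k])) ⟩
    3 * 2 ^ (3 + k) + 3 * 2 ^ (3 + k)   ≡⟨ r₂ (2 ^ (3 + k)) ⟩
    3 * 2 ^ (4 + k)                     ∎
    where
    open ≤-Reasoning
    4≤2^[3+k] : 4 ≤ 2 ^ (3 + k)
    4≤2^[3+k] = ^-monoʳ-≤ 2 {2} {3 + k} (s≤s (s≤s z≤n))
    r₁ : ∀ k → 4 * (6 + k) ≡ 4 * (5 + k) + 4
    r₁ = solve-∀
    r₂ : ∀ t → 3 * t + 3 * t ≡ 3 * (2 * t)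
    r₂ = solve-∀

  prime-between : ∀ k → let T = 2 ^ (3 + k) in ∃ λ p → Prime p × T * T < p × p ≤ 16 * (T * T)
  prime-between k with anyUpTo? (λ q → (2 ^ (3 + k) * 2 ^ (3 + k) <? q) ×-dec prime? q)
                                (suc (2 ^ (5 + k) * 2 ^ (5 + k)))
  ... | yes (p , s≤s p≤M , T²<p , pr) = p , pr , T²<p , ≤-trans p≤M (≤-reflexive (r (2 ^ (3 + k))))
    where
    r : ∀ T → 2 * (2 * T) * (2 * (2 * T)) ≡ 16 * (T * T)
    r = solve-∀
  ... | no none = contradiction (2^-reflects-≤ 2^[8T²]≤) (<⇒≱ exponents)
    where
    h = 3 + k
    T = 2 ^ h
    s = 2 ^ (2 + h)
    M = s * s
    d = T * T ∸ s
    n = pred (8 * (T * T))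
    instance
      _ : NonZero T
      _ = m^n≢0 2 h
      _ : NonZero (8 * (T * T))
      _ = m*n≢0 8 (T * T) {{_}} {{m*n≢0 T T}}
    8≤T : 8 ≤ T
    8≤T = ^-monoʳ-≤ 2 {3} {h} (m≤m+n 3 k)
    r₁ : ∀ T → 2 * (2 * T) ≡ 4 * T
    r₁ = solve-∀
    s+d : s + d ≡ T * T
    s+d = m+[n∸m]≡n (≤-trans (≤-reflexive (r₁ T)) (*-monoˡ-≤ T (≤-trans (m≤m+n 4 4) 8≤T)))
    1+n : suc n ≡ 8 * (T * T)
    1+n = suc-pred (8 * (T * T))
    1≤n : 1 ≤ n
    1≤n = s≤s⁻¹ (≤-trans (≤-trans (m≤m+n 2 6) (m≤m*n 8 (T * T) {{m*n≢0 T T}})) (≤-reflexive (sym 1+n)))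
    2n<M : suc (n + n) ≤ M
    2n<M = begin
      suc n + n                         ≤⟨ +-monoʳ-≤ (suc n) (n≤1+n n) ⟩
      suc n + suc n                     ≡⟨ cong₂ _+_ 1+n 1+n ⟩
      8 * (T * T) + 8 * (T * T)         ≡⟨ r₂ T ⟩
      2 * (2 * T) * (2 * (2 * T))       ∎
      where
      open ≤-Reasoning
      r₂ : ∀ T → 8 * (T * T) + 8 * (T * T) ≡ 2 * (2 * T) * (2 * (2 * T))
      r₂ = solve-∀
    gap : ∀ q → Prime q → q ≤ M → q ≤ s + d
    gap q pr q≤M = ≤-trans (≮⇒≥ λ T²<q → none (q , s≤s q≤M , T²<q , pr)) (≤-reflexive (sym s+d))
    T²≡2^ : T * T ≡ 2 ^ (h + h)
    T²≡2^ = sym (^-distribˡ-+-* 2 h h)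
    primorial≤ : primorial s d ≤ 2 ^ (2 * (T * T))
    primorial≤ = begin
      primorial s d                     ≤⟨ m≤n*m _ (primorial 0 s) {{>-nonZero (primorial>0 0 s)}} ⟩
      primorial 0 s * primorial s d     ≡⟨ primorial-split 0 s d ⟨
      primorial 0 (s + d)               ≡⟨ cong (primorial 0) (trans s+d T²≡2^) ⟩
      primorial 0 (2 ^ (h + h))         ≤⟨ primorial-2^ (h + h) ⟩
      2 ^ (2 * 2 ^ (h + h))             ≡⟨ cong (λ x → 2 ^ (2 * x)) T²≡2^ ⟨
      2 ^ (2 * (T * T))                 ∎
      where open ≤-Reasoning
    2^[8T²]≤ : 2 ^ (8 * (T * T)) ≤ 2 ^ ((2 + h + (2 + h)) * s + 2 * (T * T))
    2^[8T²]≤ = begin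
      2 ^ (8 * (T * T))                 ≡⟨ cong (2 ^_) 1+n ⟨
      2 ^ suc n                         ≤⟨ leibniz-diag≥2^ n 1≤n ⟩
      leibniz n n                       ≤⟨ leibniz-bound M s d n (*-mono-< (n<1+n s) (n<1+n s)) 2n<M gap ⟩
      M ^ s * primorial s d             ≡⟨ cong (λ x → x ^ s * primorial s d) (^-distribˡ-+-* 2 (2 + h) (2 + h)) ⟨
      (2 ^ (2 + h + (2 + h))) ^ s * primorial s d
                                        ≡⟨ cong (_* primorial s d) (^-*-assoc 2 (2 + h + (2 + h)) s) ⟩
      2 ^ ((2 + h + (2 + h)) * s) * primorial s d
                                        ≤⟨ *-monoʳ-≤ (2 ^ ((2 + h + (2 + h)) * s)) primorial≤ ⟩
      2 ^ ((2 + h + (2 + h)) * s) * 2 ^ (2 * (T * T))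
                                        ≡⟨ ^-distribˡ-+-* 2 ((2 + h + (2 + h)) * s) (2 * (T * T)) ⟨
      2 ^ ((2 + h + (2 + h)) * s + 2 * (T * T)) ∎
      where open ≤-Reasoning
    exponents : (2 + h + (2 + h)) * s + 2 * (T * T) < 8 * (T * T)
    exponents = begin-strict
      (2 + h + (2 + h)) * s + 2 * (T * T)       ≡⟨ r₃ h T ⟩
      2 * T * (4 * (2 + h)) + 2 * (T * T)       <⟨ +-monoˡ-< (2 * (T * T))
                                                     (*-monoʳ-< (2 * T) {{m*n≢0 2 T}} (4*[5+k]<3*2^[3+k] k)) ⟩
      2 * T * (3 * T) + 2 * (T * T)             ≡⟨ r₄ T ⟩
      8 * (T * T)                               ∎
      where
      open ≤-Reasoning
      r₃ : ∀ h T → (2 + h + (2 + h)) * (2 * (2 * T)) + 2 * (T * T) ≡ 2 * T * (4 * (2 + h)) + 2 * (T * T)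
      r₃ = solve-∀
      r₄ : ∀ T → 2 * T * (3 * T) + 2 * (T * T) ≡ 8 * (T * T)
      r₄ = solve-∀
    2^-reflects-≤ : ∀ {a b} → 2 ^ a ≤ 2 ^ b → a ≤ b
    2^-reflects-≤ le = ≮⇒≥ λ b<a → <⇒≱ (^-monoʳ-< 2 (s≤s (s≤s z≤n)) b<a) le

-- The hyperedges arise from the edges I of a bipartite graph by doubling the
-- vertices of one side: edge i joins the pair {α i, β i} to γ i.
module Doubled {n : ℕ} {I : Set} (α β γ : I → Fin n)
  (αβ : ∀ {i j} → α i ≡ α j → β i ≡ β j)
  (βα : ∀ {i j} → β i ≡ β j → α i ≡ α j)
  (α≢β : ∀ {i j} → α i ≢ β j)
  (α≢γ : ∀ {i j} → α i ≢ γ j)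
  (β≢γ : ∀ {i j} → β i ≢ γ j)
  (hexagon-free : ∀ {a b c d e f} → γ a ≡ γ b → α b ≡ α c → γ c ≡ γ d → α d ≡ α e →
                  γ e ≡ γ f → α f ≡ α a → a ≢ b → e ≢ f → f ≢ a → ⊥)
  where

  V : Set
  V = Fin n

  Incident : V → I → Set
  Incident v i = v ∈ₑ (α i , β i , γ i)

  Paired : V → I → Set
  Paired v i = (v ≡ α i) ⊎ (v ≡ β i)

  data View (v : V) (i : I) : Set where
    paired : Paired v i → View v i
    single : v ≡ γ i → View v i

  view : ∀ {v i} → Incident v i → View v i
  view (inj₁ p)        = paired (inj₁ p)
  view (inj₂ (inj₁ p)) = paired (inj₂ p)
  view (inj₂ (inj₂ p)) = single p

  same-pair : ∀ {v i j} → Paired v i → Paired v j → α i ≡ α j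
  same-pair (inj₁ p) (inj₁ q) = trans (sym p) q
  same-pair (inj₁ p) (inj₂ q) = contradiction (trans (sym p) q) α≢β
  same-pair (inj₂ p) (inj₁ q) = contradiction (trans (sym q) p) α≢β
  same-pair (inj₂ p) (inj₂ q) = βα (trans (sym p) q)

  paired≢single : ∀ {v i j} → Paired v i → v ≡ γ j → ⊥
  paired≢single (inj₁ p) q = α≢γ (trans (sym p) q)
  paired≢single (inj₂ p) q = β≢γ (trans (sym p) q)

  view-paired : ∀ {v i j} → Paired v i → Incident v j → Paired v j
  view-paired p v∈j with view v∈j
  ... | paired q = q
  ... | single q = ⊥-elim (paired≢single p q)

  view-single : ∀ {v i j} → v ≡ γ i → Incident v j → v ≡ γ j
  view-single p v∈j with view v∈j
  ... | paired q = ⊥-elim (paired≢single q p)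
  ... | single q = q

  twin-unique : ∀ {x v w i j} → Paired x i → Paired v i → x ≢ v →
                Paired x j → Paired w j → x ≢ w → v ≡ w
  twin-unique (inj₁ x) (inj₁ v) x≢v _ _ _ = contradiction (trans x (sym v)) x≢v
  twin-unique (inj₂ x) (inj₂ v) x≢v _ _ _ = contradiction (trans x (sym v)) x≢v
  twin-unique _ _ _ (inj₁ x) (inj₁ w) x≢w = contradiction (trans x (sym w)) x≢w
  twin-unique _ _ _ (inj₂ x) (inj₂ w) x≢w = contradiction (trans x (sym w)) x≢w
  twin-unique (inj₁ x) (inj₂ v) _ (inj₁ x′) (inj₂ w) _ = trans v (trans (αβ (trans (sym x) x′)) (sym w))
  twin-unique (inj₂ x) (inj₁ v) _ (inj₂ x′) (inj₁ w) _ = trans v (trans (βα (trans (sym x) x′)) (sym w))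
  twin-unique (inj₁ x) (inj₂ v) _ (inj₂ x′) (inj₁ w) _ = contradiction (trans (sym x) x′) α≢β
  twin-unique (inj₂ x) (inj₁ v) _ (inj₁ x′) (inj₂ w) _ = contradiction (trans (sym x′) x) α≢β

  quadrangle-free : ∀ {a b c d} → γ a ≡ γ b → α b ≡ α c → γ c ≡ γ d → α d ≡ α a →
                    a ≢ b → c ≢ d → d ≢ a → ⊥
  quadrangle-free ab bc cd da = hexagon-free ab refl refl bc cd da

  record BergePath (x y : V) : Set where
    field
      v w : V
      a b c : I
      x∈a : Incident x a
      v∈a : Incident v a
      v∈b : Incident v b
      w∈b : Incident w b
      w∈c : Incident w c
      y∈c : Incident y c
      x≢v : x ≢ v
      x≢w : x ≢ w
      v≢y : v ≢ y
      v≢w : v ≢ w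
      w≢y : w ≢ y
      a≢b : a ≢ b
      b≢c : b ≢ c
      a≢c : a ≢ c

  open BergePath

  reverse : ∀ {x y} → BergePath x y → BergePath y x
  reverse P = record
    { v = w P ; w = v P ; a = c P ; b = b P ; c = a P
    ; x∈a = y∈c P ; v∈a = w∈c P ; v∈b = w∈b P ; w∈b = v∈b P ; w∈c = v∈a P ; y∈c = x∈a P
    ; x≢v = ≢-sym (w≢y P) ; x≢w = ≢-sym (v≢y P) ; v≢y = ≢-sym (x≢w P) ; v≢w = ≢-sym (v≢w P) ; w≢y = ≢-sym (x≢v P)
    ; a≢b = ≢-sym (b≢c P) ; b≢c = ≢-sym (a≢b P) ; a≢c = ≢-sym (a≢c P) }

  singles-equal : ∀ {u v i j k} → u ≡ γ i → v ≡ γ j → Incident u k → Incident v k → u ≡ v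
  singles-equal p q u∈k v∈k = trans (view-single p u∈k) (sym (view-single q v∈k))

  TwinOf : V → V → Set
  TwinOf x v = ∃ λ i → Paired x i × Paired v i × x ≢ v

  twins-equal : ∀ {x v w} → TwinOf x v → TwinOf x w → v ≡ w
  twins-equal (_ , xi , vi , x≢v) (_ , xj , wj , x≢w) = twin-unique xi vi x≢v xj wj x≢w

  uses-twin : ∀ {x y i j} → Paired x i → Paired y j → (P : BergePath x y) →
              TwinOf x (v P) ⊎ TwinOf y (w P)
  uses-twin xi yj P with view (v∈a P)
  ... | paired va = inj₁ (a P , view-paired xi (x∈a P) , va , x≢v P)
  ... | single va with view (w∈b P)
  ...   | paired wb = inj₂ (c P , view-paired yj (y∈c P) , view-paired wb (w∈c P) , ≢-sym (w≢y P))
  ...   | single wb = contradiction (singles-equal va wb (v∈b P) (w∈b P)) (v≢w P)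

  no-paired-paired : ∀ {x y i j} → Paired x i → Paired y j → (P Q R : BergePath x y) →
                     v P ≢ v Q → v Q ≢ v R → v P ≢ v R → w P ≢ w Q → w Q ≢ w R → w P ≢ w R → ⊥
  no-paired-paired xi yj P Q R vPQ vQR vPR wPQ wQR wPR
    with uses-twin xi yj P | uses-twin xi yj Q | uses-twin xi yj R
  ... | inj₁ p | inj₁ q | _      = vPQ (twins-equal p q)
  ... | inj₁ p | inj₂ q | inj₁ r = vPR (twins-equal p r)
  ... | inj₁ p | inj₂ q | inj₂ r = wQR (twins-equal q r)
  ... | inj₂ p | inj₂ q | _      = wPQ (twins-equal p q)
  ... | inj₂ p | inj₁ q | inj₂ r = wPR (twins-equal p r)
  ... | inj₂ p | inj₁ q | inj₁ r = vQR (twins-equal q r)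

  no-single-single : ∀ {x y i j} → x ≡ γ i → y ≡ γ j → (P Q : BergePath x y) →
                     a P ≢ a Q → c P ≢ c Q → ⊥
  no-single-single xi yj P Q aPQ cPQ = quadrangle-free
    (trans (sym (view-single xi (x∈a P))) (view-single xi (x∈a Q)))
    (link Q)
    (trans (sym (view-single yj (y∈c Q))) (view-single yj (y∈c P)))
    (sym (link P)) aPQ (≢-sym cPQ) (≢-sym (a≢c P))
    where
    link : (P : BergePath _ _) → α (a P) ≡ α (c P)
    link P with view (v∈a P) | view (w∈c P)
    ... | single va | _ = contradiction (singles-equal xi va (x∈a P) (v∈a P)) (x≢v P)
    ... | paired va | single wc = contradiction (singles-equal wc yj (w∈c P) (y∈c P)) (w≢y P)
    ... | paired va | paired wc = trans (same-pair va (view-paired va (v∈b P)))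
                                        (same-pair (view-paired wc (w∈b P)) wc)

  no-paired-single : ∀ {x y i j} → Paired x i → y ≡ γ j → (P Q : BergePath x y) →
                     a P ≢ a Q → c P ≢ c Q → ⊥
  no-paired-single {x} {y} xi yj P Q aPQ cPQ = hexagon-free
    (proj₁ (links P)) (proj₂ (links P))
    (trans (sym (view-single yj (y∈c P))) (view-single yj (y∈c Q)))
    (sym (proj₂ (links Q))) (sym (proj₁ (links Q)))
    (same-pair (view-paired xi (x∈a Q)) (view-paired xi (x∈a P)))
    (a≢b P) (≢-sym (a≢b Q)) (≢-sym aPQ)
    where
    links : (P : BergePath x y) → γ (a P) ≡ γ (b P) × α (b P) ≡ α (c P)
    links P with view (w∈c P)
    ... | single wc = contradiction (singles-equal wc yj (w∈c P) (y∈c P)) (w≢y P)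
    ... | paired wc with view (v∈a P)
    ...   | single va = trans (sym va) (view-single va (v∈b P)) , same-pair (view-paired wc (w∈b P)) wc
    ...   | paired va = contradiction
              (twin-unique va (view-paired xi (x∈a P)) (≢-sym (x≢v P))
                           (view-paired va (v∈b P)) (view-paired wc (w∈b P)) (v≢w P))
              (x≢w P)

  no-three-paths : ∀ {x y} (P Q R : BergePath x y) →
                   v P ≢ v Q → v Q ≢ v R → v P ≢ v R → w P ≢ w Q → w Q ≢ w R → w P ≢ w R →
                   a P ≢ a Q → c P ≢ c Q → ⊥
  no-three-paths P Q R vPQ vQR vPR wPQ wQR wPR aPQ cPQ with view (x∈a P) | view (y∈c P)
  ... | paired xa | paired yc = no-paired-paired xa yc P Q R vPQ vQR vPR wPQ wQR wPR
  ... | single xa | single yc = no-single-single xa yc P Q aPQ cPQ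
  ... | paired xa | single yc = no-paired-single xa yc P Q aPQ cPQ
  ... | single xa | paired yc = no-paired-single yc xa (reverse P) (reverse Q) cPQ aPQ


  theta-free : ∀ t (H : Hypergraph3 n) (ι : Fin (length (edges H)) → I) → Injective _≡_ _≡_ ι →
               (∀ k → lookup (edges H) k ≡ (α (ι k) , β (ι k) , γ (ι k))) →
               ¬ ContainsBergeTheta 3 (3 ℕ.+ t) H
  theta-free t H ι ι-inj lookup≡ (φ , e , φ-inj , e-inj , inc) =
    no-three-paths (path 0F) (path 1F) (path 2F)
      (λ q → case φ-inj q of λ ()) (λ q → case φ-inj q of λ ()) (λ q → case φ-inj q of λ ())
      (λ q → case φ-inj q of λ ()) (λ q → case φ-inj q of λ ()) (λ q → case φ-inj q of λ ())
      (λ q → case e-inj (ι-inj q) of λ ()) (λ q → case e-inj (ι-inj q) of λ ())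
    where
    incident : ∀ {u} k → u ∈ₑ lookup (edges H) k → Incident u (ι k)
    incident {u} k = subst (u ∈ₑ_) (lookup≡ k)

    path : Fin (3 ℕ.+ t) → BergePath (φ (inj₁ 0F)) (φ (inj₁ 1F))
    path i = record
      { v = φ (inj₂ (i , 0F)) ; w = φ (inj₂ (i , 1F))
      ; a = ι (e (i , 0F)) ; b = ι (e (i , 1F)) ; c = ι (e (i , 2F))
      ; x∈a = incident _ (proj₁ (inc i 0F)) ; v∈a = incident _ (proj₂ (inc i 0F))
      ; v∈b = incident _ (proj₁ (inc i 1F)) ; w∈b = incident _ (proj₂ (inc i 1F))
      ; w∈c = incident _ (proj₁ (inc i 2F)) ; y∈c = incident _ (proj₂ (inc i 2F))
      ; x≢v = λ q → case φ-inj q of λ () ; x≢w = λ q → case φ-inj q of λ ()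
      ; v≢w = λ q → case φ-inj q of λ () ; v≢y = λ q → case φ-inj q of λ ()
      ; w≢y = λ q → case φ-inj q of λ ()
      ; a≢b = λ q → case e-inj (ι-inj q) of λ () ; b≢c = λ q → case e-inj (ι-inj q) of λ ()
      ; a≢c = λ q → case e-inj (ι-inj q) of λ () }

module Wenger (p : ℕ) (p-prime : Prime p) where

  open import Data.Integer as ℤ using (ℤ; +_; _+_; _*_; _-_; ∣_∣)
  import Data.Integer.Properties as ℤ
  open import Data.Integer.Tactic.RingSolver using (solve-∀)
  import Data.Nat.Divisibility as ℕ∣

  instance
    p≢0 : NonZero p
    p≢0 = prime⇒nonZero p-prime

  mod≡⇒ : ∀ m n → m mod p ≡ n mod p → ∃ λ k → + m ≡ + n + k * + p
  mod≡⇒ m n eq = + (m / p) - + (n / p) , (begin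
    + m                                              ≡⟨ expand m ⟩
    + (m % p) + + (m / p) * + p                      ≡⟨ cong (λ r → + r + + (m / p) * + p) m%p≡n%p ⟩
    + (n % p) + + (m / p) * + p                      ≡⟨ shift (+ (n % p)) (+ (m / p)) (+ (n / p)) (+ p) ⟩
    + (n % p) + + (n / p) * + p + (+ (m / p) - + (n / p)) * + p
                                                     ≡⟨ cong (_+ (+ (m / p) - + (n / p)) * + p) (expand n) ⟨
    + n + (+ (m / p) - + (n / p)) * + p              ∎)
    where
    open ≡-Reasoning
    m%p≡n%p : m % p ≡ n % p
    m%p≡n%p = trans (sym (toℕ-fromℕ< (m%n<n m p))) (trans (cong toℕ eq) (toℕ-fromℕ< (m%n<n n p)))
    expand : ∀ m → + m ≡ + (m % p) + + (m / p) * + p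
    expand m = trans (cong +_ (m≡m%n+[m/n]*n m p))
      (trans (ℤ.pos-+ (m % p) _) (cong (λ z → + (m % p) + z) (ℤ.pos-* (m / p) p)))
    shift : ∀ r a b p → r + a * p ≡ r + b * p + (a - b) * p
    shift = solve-∀

  toℤ : Fin p → ℤ
  toℤ i = + toℕ i

  p∣diff⇒≡ : ∀ i j → p ℕ∣.∣ ∣ toℤ i - toℤ j ∣ → i ≡ j
  p∣diff⇒≡ i j p∣ with ∣ toℤ i - toℤ j ∣ in eq
  ... | zero  = toℕ-injective (ℤ.+-injective (ℤ.i-j≡0⇒i≡j (toℤ i) (toℤ j) (ℤ.∣i∣≡0⇒i≡0 eq)))
  ... | suc d = contradiction (ℕ∣.∣⇒≤ p∣) (ℕ.<⇒≱ (subst (ℕ._< p) eq diff<p))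
    where
    diff<p : ∣ toℤ i - toℤ j ∣ ℕ.< p
    diff<p rewrite ℤ.m-n≡m⊖n (toℕ i) (toℕ j) =
      ℕ.≤-<-trans (ℤ.∣m⊝n∣≤m⊔n (toℕ i) (toℕ j)) (ℕ.⊔-lub (toℕ<n i) (toℕ<n j))

  multiple⇒p∣ : ∀ {i} k → i ≡ k * + p → p ℕ∣.∣ ∣ i ∣
  multiple⇒p∣ k eq = ℕ∣.divides ∣ k ∣ (trans (cong ∣_∣ eq) (ℤ.abs-* k (+ p)))

  p∣* : ∀ i j → p ℕ∣.∣ ∣ i * j ∣ → p ℕ∣.∣ ∣ i ∣ ⊎ p ℕ∣.∣ ∣ j ∣
  p∣* i j p∣ = euclidsLemma ∣ i ∣ ∣ j ∣ p-prime (subst (p ℕ∣.∣_) (ℤ.abs-* i j) p∣)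

  Index : Set
  Index = Fin p × Fin p × Fin p × Fin p

  X Y : Index → Fin p
  X (x , y , u , v) = x
  Y (x , y , u , v) = y

  Node : Set
  Node = Fin p × Fin p × Fin p

  affine : ℕ → Fin p → Fin p → Fin p
  affine s y u = (s ℕ.* toℕ y ℕ.+ toℕ u) mod p

  point line : Index → Node
  point (x , y , u , v) = x , u , v
  line  (x , y , u , v) = y , affine (toℕ x) y u , affine (toℕ x ℕ.* toℕ x) y v

  affine≡⇒ : ∀ s t y z u w → affine s y u ≡ affine t z w →
             ∃ λ k → + s * toℤ y + toℤ u ≡ + t * toℤ z + toℤ w + k * + p
  affine≡⇒ s t y z u w eq with mod≡⇒ (s ℕ.* toℕ y ℕ.+ toℕ u) (t ℕ.* toℕ z ℕ.+ toℕ w) eq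
  ... | k , eq′ = k , trans (sym (pos-affine s y u)) (trans eq′ (cong (λ i → i + k * + p) (pos-affine t z w)))
    where
    pos-affine : ∀ s y u → + (s ℕ.* toℕ y ℕ.+ toℕ u) ≡ + s * toℤ y + toℤ u
    pos-affine s y u = trans (ℤ.pos-+ (s ℕ.* toℕ y) (toℕ u)) (cong (λ i → i + toℤ u) (ℤ.pos-* s (toℕ y)))

  affine²≡⇒ : ∀ s t y z u w → affine (toℕ s ℕ.* toℕ s) y u ≡ affine (toℕ t ℕ.* toℕ t) z w →
              ∃ λ k → toℤ s * toℤ s * toℤ y + toℤ u ≡ toℤ t * toℤ t * toℤ z + toℤ w + k * + p
  affine²≡⇒ s t y z u w eq
    with k , eq′ ← affine≡⇒ (toℕ s ℕ.* toℕ s) (toℕ t ℕ.* toℕ t) y z u w eq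
    = k , subst₂ (λ a b → a * toℤ y + toℤ u ≡ b * toℤ z + toℤ w + k * + p)
                 (ℤ.pos-* (toℕ s) (toℕ s)) (ℤ.pos-* (toℕ t) (toℕ t)) eq′

  affine-injective : ∀ s y u w → affine s y u ≡ affine s y w → u ≡ w
  affine-injective s y u w eq with affine≡⇒ s s y y u w eq
  ... | k , eq′ = p∣diff⇒≡ u w (multiple⇒p∣ k (begin
    toℤ u - toℤ w                                      ≡⟨ r₁ (+ s * toℤ y) (toℤ u) (toℤ w) ⟩
    + s * toℤ y + toℤ u - (+ s * toℤ y + toℤ w)        ≡⟨ cong (λ i → i - (+ s * toℤ y + toℤ w)) eq′ ⟩
    + s * toℤ y + toℤ w + k * + p - (+ s * toℤ y + toℤ w) ≡⟨ r₂ (+ s * toℤ y + toℤ w) (k * + p) ⟩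
    k * + p ∎))
    where
    open ≡-Reasoning
    r₁ : ∀ a u w → u - w ≡ a + u - (a + w)
    r₁ = solve-∀
    r₂ : ∀ a b → a + b - a ≡ b
    r₂ = solve-∀

  line-X-injective : ∀ i j → line i ≡ line j → X i ≡ X j → i ≡ j
  line-X-injective (x , y , u , v) (x′ , y′ , u′ , v′) eq refl with cong proj₁ eq
  ... | refl with affine-injective (toℕ x) y u u′ (cong (λ l → proj₁ (proj₂ l)) eq)
                | affine-injective (toℕ x ℕ.* toℕ x) y v v′ (cong (λ l → proj₂ (proj₂ l)) eq)
  ...   | refl | refl = refl

  point-Y-injective : ∀ i j → point i ≡ point j → Y i ≡ Y j → i ≡ j
  point-Y-injective (x , y , u , v) (x′ , y′ , u′ , v′) refl refl = refl

  -- Eliminating x₁ and x₂ from the telescoped relations of degrees 1 and 2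
  -- in the x's is a Vandermonde computation.
  vandermonde : ∀ x₀ x₁ x₂ y₁ y y₂ u₀ u₁ u₂ v₀ v₁ v₂ k₁ k₂ k₃ m₁ m₂ m₃ q →
    x₀ * y₁ + u₀ ≡ x₁ * y₁ + u₁ + k₁ * q →
    x₁ * y  + u₁ ≡ x₂ * y  + u₂ + k₂ * q →
    x₂ * y₂ + u₂ ≡ x₀ * y₂ + u₀ + k₃ * q →
    x₀ * x₀ * y₁ + v₀ ≡ x₁ * x₁ * y₁ + v₁ + m₁ * q →
    x₁ * x₁ * y  + v₁ ≡ x₂ * x₂ * y  + v₂ + m₂ * q →
    x₂ * x₂ * y₂ + v₂ ≡ x₀ * x₀ * y₂ + v₀ + m₃ * q →
    (x₀ - x₁) * ((x₀ - x₂) * (y₁ - y₂)) ≡ (m₁ + m₂ + m₃ - (x₁ + x₂) * (k₁ + k₂ + k₃)) * q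
  vandermonde x₀ x₁ x₂ y₁ y y₂ u₀ u₁ u₂ v₀ v₁ v₂ k₁ k₂ k₃ m₁ m₂ m₃ q e₁ e₂ e₃ f₁ f₂ f₃ = begin
    (x₀ - x₁) * ((x₀ - x₂) * (y₁ - y₂))
      ≡⟨ r₁ x₀ x₁ x₂ y₁ y y₂ u₀ u₁ u₂ v₀ v₁ v₂ ⟩
    ((x₀ * x₀ * y₁ + v₀) - (x₁ * x₁ * y₁ + v₁) + ((x₁ * x₁ * y + v₁) - (x₂ * x₂ * y + v₂))
       + ((x₂ * x₂ * y₂ + v₂) - (x₀ * x₀ * y₂ + v₀)))
    - (x₁ + x₂) * ((x₀ * y₁ + u₀) - (x₁ * y₁ + u₁) + ((x₁ * y + u₁) - (x₂ * y + u₂))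
       + ((x₂ * y₂ + u₂) - (x₀ * y₂ + u₀)))
      ≡⟨ cong₂ (λ i j → i - (x₁ + x₂) * j)
           (cong₂ _+_ (cong₂ _+_ (difference _ _ f₁) (difference _ _ f₂)) (difference _ _ f₃))
           (cong₂ _+_ (cong₂ _+_ (difference _ _ e₁) (difference _ _ e₂)) (difference _ _ e₃)) ⟩
    (m₁ * q + m₂ * q + m₃ * q) - (x₁ + x₂) * (k₁ * q + k₂ * q + k₃ * q)
      ≡⟨ r₂ x₁ x₂ k₁ k₂ k₃ m₁ m₂ m₃ q ⟩
    (m₁ + m₂ + m₃ - (x₁ + x₂) * (k₁ + k₂ + k₃)) * q ∎
    where
    open ≡-Reasoning
    difference : ∀ {i} j k → i ≡ j + k → i - j ≡ k
    difference j k refl = cancel j k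
      where
      cancel : ∀ j k → j + k - j ≡ k
      cancel = solve-∀
    r₁ : ∀ x₀ x₁ x₂ y₁ y y₂ u₀ u₁ u₂ v₀ v₁ v₂ →
      (x₀ - x₁) * ((x₀ - x₂) * (y₁ - y₂)) ≡
      ((x₀ * x₀ * y₁ + v₀) - (x₁ * x₁ * y₁ + v₁) + ((x₁ * x₁ * y + v₁) - (x₂ * x₂ * y + v₂))
         + ((x₂ * x₂ * y₂ + v₂) - (x₀ * x₀ * y₂ + v₀)))
      - (x₁ + x₂) * ((x₀ * y₁ + u₀) - (x₁ * y₁ + u₁) + ((x₁ * y + u₁) - (x₂ * y + u₂))
         + ((x₂ * y₂ + u₂) - (x₀ * y₂ + u₀)))
    r₁ = solve-∀
    r₂ : ∀ x₁ x₂ k₁ k₂ k₃ m₁ m₂ m₃ q →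
      (m₁ * q + m₂ * q + m₃ * q) - (x₁ + x₂) * (k₁ * q + k₂ * q + k₃ * q) ≡
      (m₁ + m₂ + m₃ - (x₁ + x₂) * (k₁ + k₂ + k₃)) * q
    r₂ = solve-∀

  hexagon-free : ∀ {a b c d e f} → line a ≡ line b → point b ≡ point c → line c ≡ line d →
                 point d ≡ point e → line e ≡ line f → point f ≡ point a → a ≢ b → e ≢ f → f ≢ a → ⊥
  hexagon-free {a@(x₀ , y₁ , u₀ , v₀)} {b@(x₁ , _ , u₁ , v₁)} {_ , y , _} {d@(x₂ , _ , u₂ , v₂)}
               {e@(_ , y₂ , _)} {f} ab refl cd refl ef refl a≢b e≢f f≢a
    with cong proj₁ ab | cong proj₁ cd | cong proj₁ ef
  ... | refl | refl | refl
    with k₁ , e₁ ← affine≡⇒ (toℕ x₀) (toℕ x₁) y₁ y₁ u₀ u₁ (cong (λ l → proj₁ (proj₂ l)) ab)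
       | k₂ , e₂ ← affine≡⇒ (toℕ x₁) (toℕ x₂) y y u₁ u₂ (cong (λ l → proj₁ (proj₂ l)) cd)
       | k₃ , e₃ ← affine≡⇒ (toℕ x₂) (toℕ x₀) y₂ y₂ u₂ u₀ (cong (λ l → proj₁ (proj₂ l)) ef)
       | m₁ , f₁ ← affine²≡⇒ x₀ x₁ y₁ y₁ v₀ v₁ (cong (λ l → proj₂ (proj₂ l)) ab)
       | m₂ , f₂ ← affine²≡⇒ x₁ x₂ y y v₁ v₂ (cong (λ l → proj₂ (proj₂ l)) cd)
       | m₃ , f₃ ← affine²≡⇒ x₂ x₀ y₂ y₂ v₂ v₀ (cong (λ l → proj₂ (proj₂ l)) ef)
    with p∣* (toℤ x₀ - toℤ x₁) _ (multiple⇒p∣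
           (m₁ + m₂ + m₃ - (toℤ x₁ + toℤ x₂) * (k₁ + k₂ + k₃))
           (vandermonde (toℤ x₀) (toℤ x₁) (toℤ x₂) (toℤ y₁) (toℤ y) (toℤ y₂) (toℤ u₀) (toℤ u₁) (toℤ u₂)
              (toℤ v₀) (toℤ v₁) (toℤ v₂) k₁ k₂ k₃ m₁ m₂ m₃ (+ p) e₁ e₂ e₃ f₁ f₂ f₃))
  ... | inj₁ p∣ = a≢b (line-X-injective a b ab (p∣diff⇒≡ x₀ x₁ p∣))
  ... | inj₂ p∣ with p∣* (toℤ x₀ - toℤ x₂) (toℤ y₁ - toℤ y₂) p∣
  ...   | inj₁ p∣ = e≢f (line-X-injective e f ef (sym (p∣diff⇒≡ x₀ x₂ p∣)))
  ...   | inj₂ p∣ = f≢a (point-Y-injective f a refl (sym (p∣diff⇒≡ y₁ y₂ p∣)))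

  node : Node → Fin (p ℕ.* (p ℕ.* p))
  node (a , b , c) = combine a (combine b c)

  node-injective : ∀ {s t} → node s ≡ node t → s ≡ t
  node-injective {a , b , c} {a′ , b′ , c′} eq
    with refl , eq′ ← combine-injective a (combine b c) a′ (combine b′ c′) eq
    with refl , refl ← combine-injective b c b′ c′ eq′ = refl

  index : Fin (p ℕ.* (p ℕ.* (p ℕ.* p))) → Index
  index i = map₂ (map₂ (remQuot p) ∘ remQuot (p ℕ.* p)) (remQuot (p ℕ.* (p ℕ.* p)) i)

  remQuot-injective : ∀ {m} k {i j : Fin (m ℕ.* k)} → remQuot {m} k i ≡ remQuot k j → i ≡ j
  remQuot-injective {m} k {i} {j} eq =
    trans (sym (combine-remQuot {m} k i)) (trans (cong (λ (a , b) → combine a b) eq) (combine-remQuot {m} k j))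

  index-injective : Injective _≡_ _≡_ index
  index-injective eq with eq₁ , eq′ ← ,-injective eq with eq₂ , eq″ ← ,-injective eq′ =
    remQuot-injective _ (cong₂ _,_ eq₁ (remQuot-injective _ (cong₂ _,_ eq₂ (remQuot-injective _ eq″))))

  module _ {n : ℕ} (3p³≤n : 3 ℕ.* (p ℕ.* (p ℕ.* p)) ℕ.≤ n) where

    place : Fin 3 → Node → Fin n
    place c s = inject≤ (combine c (node s)) 3p³≤n

    place-injective : ∀ {c d s t} → place c s ≡ place d t → c ≡ d × s ≡ t
    place-injective {c} {d} {s} {t} eq
      with c≡d , eq′ ← combine-injective c (node s) d (node t) (inject≤-injective 3p³≤n 3p³≤n _ _ eq) =
      c≡d , node-injective eq′

    place-mono : ∀ {c d} s t → c Fin.< d → place c s Fin.< place d t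
    place-mono {c} {d} s t c<d = subst₂ ℕ._<_ (sym (toℕ-inject≤ _ 3p³≤n)) (sym (toℕ-inject≤ _ 3p³≤n))
      (combine-monoˡ-< (node s) (node t) c<d)

    α β γ : Index → Fin n
    α i = place 0F (point i)
    β i = place 1F (point i)
    γ i = place 2F (line i)

    α⇒point : ∀ i j → α i ≡ α j → point i ≡ point j
    α⇒point i j eq = proj₂ (place-injective {0F} {0F} eq)

    γ⇒line : ∀ i j → γ i ≡ γ j → line i ≡ line j
    γ⇒line i j eq = proj₂ (place-injective {2F} {2F} eq)

    edge : Fin (p ℕ.* (p ℕ.* (p ℕ.* p))) → Triple n
    edge k = α (index k) , β (index k) , γ (index k)

    edge-injective : ∀ {k l} → edge k ≡ edge l → k ≡ l
    edge-injective {k} {l} eq = index-injective (line-X-injective (index k) (index l)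
      (γ⇒line (index k) (index l) (cong (proj₂ ∘ proj₂) eq))
      (cong proj₁ (α⇒point (index k) (index l) (cong proj₁ eq))))

    wenger : Hypergraph3 n
    wenger = record
      { edges      = tabulate edge
      ; increasing = All.tabulate⁺ λ k → place-mono {0F} {1F} (point (index k)) (point (index k)) z<s ,
                                         place-mono {1F} {2F} (point (index k)) (line (index k)) (s<s z<s)
      ; distinct   = Unique.tabulate⁺ edge-injective
      }

    ∣wenger∣ : ∣E∣ wenger ≡ p ℕ.* (p ℕ.* (p ℕ.* p))
    ∣wenger∣ = length-tabulate edge

    wenger-theta-free : ∀ t → ¬ ContainsBergeTheta 3 (3 ℕ.+ t) wenger
    wenger-theta-free t =
      theta-free t wenger (index ∘ position) (position-injective ∘ index-injective) lookup-edge
      where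
      open Doubled α β γ
        (λ {i} {j} eq → cong (place 1F) (α⇒point i j eq))
        (λ {i} {j} eq → cong (place 0F) (proj₂ (place-injective {1F} {1F} {point i} {point j} eq)))
        (λ {i} {j} eq → case proj₁ (place-injective {0F} {1F} {point i} {point j} eq) of λ ())
        (λ {i} {j} eq → case proj₁ (place-injective {0F} {2F} {point i} {line j} eq) of λ ())
        (λ {i} {j} eq → case proj₁ (place-injective {1F} {2F} {point i} {line j} eq) of λ ())
        (λ {a} {b} {c} {d} {e} {f} ab bc cd de ef fa → hexagon-free
          (γ⇒line a b ab) (α⇒point b c bc) (γ⇒line c d cd) (α⇒point d e de) (γ⇒line e f ef) (α⇒point f a fa))

      position : Fin (length (tabulate edge)) → Fin (p ℕ.* (p ℕ.* (p ℕ.* p)))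
      position = cast (length-tabulate edge)

      position-injective : Injective _≡_ _≡_ position
      position-injective {k} {l} eq = trans (sym (cast-involutive (sym ∣wenger∣) ∣wenger∣ k))
        (trans (cong (cast _) eq) (cast-involutive (sym ∣wenger∣) ∣wenger∣ l))

      lookup-edge : ∀ k → lookup (tabulate edge) k ≡ edge (position k)
      lookup-edge k = trans (cong (lookup (tabulate edge)) (sym (cast-involutive (sym ∣wenger∣) ∣wenger∣ k)))
                            (lookup-tabulate edge (position k))

open import Data.Nat using (_+_; _*_; _^_; _≤_; _<_; z≤n; s≤s)
open import Data.Nat.Properties
open import Data.Nat.Tactic.RingSolver using (solve-∀)
open Primes using (bracket; prime-between)

cube : ℕ → ℕ
cube w = w * (w * w)

cube-mono-≤ : ∀ {v w} → v ≤ w → cube v ≤ cube w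
cube-mono-≤ v≤w = *-mono-≤ v≤w (*-mono-≤ v≤w v≤w)

cube-mono-< : ∀ {v w} → v < w → cube v < cube w
cube-mono-< v<w = *-mono-< v<w (*-mono-< v<w v<w)

^4≤^3 : ∀ {c q} → c ^ 4 ≤ q ^ 3 → ∀ {n w p} → n ≤ c * cube w → w ≤ p →
        n ^ 4 ≤ q ^ 3 * (p * cube p) ^ 3
^4≤^3 {c} {q} c⁴≤q³ {n} {w} {p} n≤ w≤p = begin
  n ^ 4                        ≤⟨ ^-monoˡ-≤ 4 n≤ ⟩
  (c * cube w) ^ 4             ≡⟨ r c w ⟩
  c ^ 4 * (w * cube w) ^ 3     ≤⟨ *-mono-≤ c⁴≤q³ (^-monoˡ-≤ 3 (*-mono-≤ w≤p (cube-mono-≤ w≤p))) ⟩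
  q ^ 3 * (p * cube p) ^ 3     ∎
  where
  open ≤-Reasoning
  r : ∀ c w → let a = c * (w * (w * w)) ; b = w * (w * (w * w)) in
      a * (a * (a * (a * 1))) ≡ c * (c * (c * (c * 1))) * (b * (b * (b * 1)))
  r = solve-∀

scaledCube : ℕ → ℕ → ℕ → ℕ
scaledCube d a s = d * cube (a * s)

scaledCube-* : ∀ d a b s → scaledCube d a (b * s) ≡ d * cube (a * b) * cube s
scaledCube-* = expanded
  where
  expanded : ∀ d a b s → d * (a * (b * s) * (a * (b * s) * (a * (b * s)))) ≡
                         d * (a * b * (a * b * (a * b))) * (s * (s * s))
  expanded = solve-∀

scaledCube-mono-< : ∀ d a .{{_ : NonZero d}} .{{_ : NonZero a}} {s t} → s < t → scaledCube d a s < scaledCube d a t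
scaledCube-mono-< d a s<t = *-monoʳ-< d (cube-mono-< (*-monoʳ-< a s<t))

scale : ℕ → ℕ
scale k = 2 ^ (3 + k) * 2 ^ (3 + k)

scale-mono : ∀ k → scale k < scale (suc k)
scale-mono k = *-mono-< 2^< 2^<
  where
  2^< : 2 ^ (3 + k) < 2 ^ (4 + k)
  2^< = ^-monoʳ-< 2 (s≤s (s≤s z≤n)) (n<1+n (3 + k))

scale-suc : ∀ k → scale (suc k) ≡ 4 * scale k
scale-suc k = r (2 ^ (3 + k))
  where
  r : ∀ t → 2 * t * (2 * t) ≡ 4 * (t * t)
  r = solve-∀

dense : ∀ q → (3 * cube (16 * 4)) ^ 4 ≤ q ^ 3 → ∀ n → scaledCube 3 16 (scale 0) ≤ n →
        Σ (Hypergraph3 n) λ H → (¬ ContainsBergeTheta 3 217 H) × (1 ^ 3 * n ^ 4 ≤ q ^ 3 * ∣E∣ H ^ 3)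
dense q c⁴≤q³ n n₀≤n
  with k , lower , upper ← bracket (λ k → scaledCube 3 16 (scale k)) (λ k → scaledCube-mono-< 3 16 (scale-mono k)) n n₀≤n
  with p , p-prime , s<p , p≤16s ← prime-between k =
    wenger 3p³≤n , wenger-theta-free 3p³≤n 214 , (begin
      1 ^ 3 * n ^ 4                     ≡⟨ *-identityˡ (n ^ 4) ⟩
      n ^ 4                             ≤⟨ ^4≤^3 {3 * cube (16 * 4)} {q} c⁴≤q³ {n} {scale k} {p} n≤ (<⇒≤ s<p) ⟩
      q ^ 3 * (p * cube p) ^ 3          ≡⟨ cong (λ e → q ^ 3 * e ^ 3) (∣wenger∣ 3p³≤n) ⟨
      q ^ 3 * ∣E∣ (wenger 3p³≤n) ^ 3    ∎)
  where
  open Wenger p p-prime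
  open ≤-Reasoning
  n≤ : n ≤ 3 * cube (16 * 4) * cube (scale k)
  n≤ = ≤-trans (<⇒≤ upper)
    (≤-reflexive (trans (cong (scaledCube 3 16) (scale-suc k)) (scaledCube-* 3 16 4 (scale k))))
  3p³≤n : 3 * cube p ≤ n
  3p³≤n = ≤-trans (*-monoʳ-≤ 3 (cube-mono-≤ p≤16s)) lower

theorem1 : Σ ℕ λ p → Σ ℕ λ q → (0 < p) × (0 < q) × (Σ ℕ λ n₀ → (n : ℕ) → n₀ ≤ n →
    Σ (Hypergraph3 n) λ H → (¬ ContainsBergeTheta 3 217 H) ×
    (p ^ 3 * n ^ 4 ≤ q ^ 3 * ∣E∣ H ^ 3))
theorem1 = 1 , 2 ^ 27 , z<s , m^n>0 2 27 , scaledCube 3 16 (scale 0) , dense (2 ^ 27) (≤ᵇ⇒≤ _ _ tt)
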